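{- Assume Markov induction. Every surjective function $f:\nabla_0\mathbb{N}\to\nabla_0\mathbb{N}$ has a section $s:\nabla_0\mathbb{N}\to\nabla_0\mathbb{N}$ (i.e. $f\circ s=\mathrm{id}$) with $s\le_T f$. If $f$ is a bijection with inverse $f^{ -1}$, then $f^{ -1}\equiv_T f$.
   Context: Setting: homotopy type theory with a univalent universe $\mathcal{U}$ of small types and higher inductive types. It is assumed that there is a small type $\Omega_{\neg\neg}:\mathcal{U}$ classifying $\neg\neg$-stable propositions. For a type $X$, $\nabla_0X$ is the type of $\xi:X\to\Omega_{\neg\neg}$ such that $\neg\neg\sum_{x:X}\xi(x)$ and $\prod_{x,y:X}\xi(x)\to\xi(y)\to\neg\neg(x=y)$; write $\xi\downarrow:=\sum_{x:X}\xi(x)$ and $\xi\downarrow=x$ for $\xi(x)$; the unit $\iota:X\to\nabla_0X$ sends $x$ to $\lambda y.\neg\neg(x=y)$. Surjective means $\prod_\nu\|\sum_\mu f(\mu)=\nu\|$. For a higher modality $\bigcirc$, a type $X$ is $\bigcirc$-connected if $\bigcirc X$ is contractible. The nullification at a family $B:A\to\mathcal{U}$ is the higher modality whose modal types are the $X$ with every constant map $X\to X^{B(a)}$ an equivalence. An oracle is a map $\chi:A\to\nabla_0B$; $\bigcirc_\chi$ is the nullification at $a\mapsto\chi(a)\downarrow$. A function $g:\nabla_0\mathbb{N}\to\nabla_0\mathbb{N}$ is regarded as the oracle $g\circ\iota:\mathbb{N}\to\nabla_0\mathbb{N}$ (maps $\mathbb{N}\to\nabla_0\mathbb{N}$ correspond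 uniquely to maps $\nabla_0\mathbb{N}\to\nabla_0\mathbb{N}$). $\bigcirc\le_T\Diamond$ means every $\bigcirc$-connected type is $\Diamond$-connected; $\chi\le_T\chi'$ means $\bigcirc_\chi\le_T\bigcirc_{\chi'}$; $\chi\equiv_T\chi'$ means $\bigcirc_\chi=\bigcirc_{\chi'}$. Markov induction (MI): write $\mathtt{IsSuc}(\mu,\nu):=\prod_{m:\mathbb{N}}(\mu\downarrow=m)\to(\nu\downarrow=m+1)$; MI asserts that for every $P:\nabla_0\mathbb{N}\to\mathcal{U}$ and every $h:\prod_{\nu:\nabla_0\mathbb{N}}\left(\prod_{\mu:\nabla_0\mathbb{N}}\mathtt{IsSuc}(\mu,\nu)\to P(\mu)\right)\to P(\nu)$ there is a section $\prod_{\nu:\nabla_0\mathbb{N}}P(\nu)$. -}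

{-# OPTIONS --safe --without-K #-}
module Defs where

open import Axiom.Extensionality.Propositional using (Extensionality)
open import Data.Nat using (ℕ; suc)
open import Data.Product using (Σ; _×_; _,_; proj₁; proj₂; ∃)
open import Function.Base using (id; const; _∘_)
open import Function.Bundles using (_⇔_)
open import Agda.Primitive using (Level; _⊔_; Setω)
open import Relation.Binary.PropositionalEquality using (_≡_; refl; sym; cong; subst)
open import Relation.Nullary.Irrelevant using (Irrelevant)
open import Relation.Nullary.Negation using (¬_; Stable; contradiction; negated-stable)

private
  variable
    a b : Level

IsContr : Set a → Set a
IsContr X = Σ X λ x → ∀ y → x ≡ y

fiber : {X : Set a} {Y : Set b} → (X → Y) → Y → Set (a ⊔ b)
fiber f y = ∃ λ x → f x ≡ y

IsEquiv : {X : Set a} {Y : Set b} → (X → Y) → Set (a ⊔ b)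
IsEquiv f = ∀ y → IsContr (fiber f y)

_≃_ : Set a → Set b → Set (a ⊔ b)
X ≃ Y = Σ (X → Y) IsEquiv

≃-refl : (X : Set a) → X ≃ X
≃-refl X = id , λ y → (y , refl) , λ { (_ , refl) → refl }

≡⇒≃ : (X Y : Set) → X ≡ Y → X ≃ Y
≡⇒≃ X .X refl = ≃-refl X

Univalence : Set₁
Univalence = (X Y : Set) → IsEquiv (≡⇒≃ X Y)

-- Higher modalities in the sense of Rijke, Shulman and Spitters,
-- "Modalities in homotopy type theory".
record HigherModality : Set₁ where
  field
    ○    : Set → Set
    η    : (X : Set) → X → ○ X
    ind  : (X : Set) (Y : ○ X → Set) →
           ((x : X) → ○ (Y (η X x))) → (z : ○ X) → ○ (Y z)
    ind-η : (X : Set) (Y : ○ X → Set) (f : (x : X) → ○ (Y (η X x))) (x : X) →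
            ind X Y f (η X x) ≡ f x
    ≡-modal : (X : Set) (x y : ○ X) → IsEquiv (η (x ≡ y))

  IsModal : Set → Set
  IsModal X = IsEquiv (η X)

  IsConnected : Set → Set
  IsConnected X = IsContr (○ X)

open HigherModality public using (IsModal; IsConnected)

IsNull : {A : Set} → (A → Set) → Set → Set
IsNull {A} B X = (a : A) → IsEquiv (const {A = X} {B = B a})

¬¬StableProp : Set₁
¬¬StableProp = Σ Set λ P → Irrelevant P × Stable P

-- The features of the ambient type theory that plain Agda does not provide.
-- The univalent universe 𝒰 is Set.  Of the higher inductive types only
-- propositional truncation and nullification are used; the latter is given as
-- a higher modality with the prescribed modal types, which determine it.
-- Univalence contradicts axiom K, so this record is meant for use under
-- the option without-K only.
record HoTT : Setω where
  field
    funext     : ∀ {a b} → Extensionality a b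
    univalence : Univalence

    ∥_∥        : Set → Set
    ∣_∣        : {X : Set} → X → ∥ X ∥
    ∥∥-isProp  : {X : Set} → Irrelevant ∥ X ∥
    ∥∥-elim    : ∀ {ℓ} {X : Set} {P : ∥ X ∥ → Set ℓ} →
                 (∀ t → Irrelevant (P t)) → (∀ x → P ∣ x ∣) → ∀ t → P t

    Nullification : {A : Set} → (A → Set) → HigherModality
    modal⇔null    : {A : Set} (B : A → Set) (X : Set) →
                    IsModal (Nullification B) X ⇔ IsNull B X

    Ω¬¬      : Set
    classify : Ω¬¬ ≃ ¬¬StableProp

module Theory (H : HoTT) where
  open HoTT H public

  Holds : Ω¬¬ → Set
  Holds p = proj₁ (proj₁ classify p)

  code : ¬¬StableProp → Ω¬¬
  code P = proj₁ (proj₁ (proj₂ classify P))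

  Holds-code : (P : ¬¬StableProp) → Holds (code P) ≡ proj₁ P
  Holds-code P = cong proj₁ (proj₂ (proj₁ (proj₂ classify P)))

  ∇₀ : Set → Set
  ∇₀ X = Σ (X → Ω¬¬) λ ξ →
           (¬ ¬ Σ X λ x → Holds (ξ x)) ×
           ((x y : X) → Holds (ξ x) → Holds (ξ y) → ¬ ¬ (x ≡ y))

  _↓=_ : {X : Set} → ∇₀ X → X → Set
  (ξ , _) ↓= x = Holds (ξ x)

  _↓ : {X : Set} → ∇₀ X → Set
  _↓ {X} ξ = Σ X λ x → ξ ↓= x

  ¬¬-stableProp : Set → ¬¬StableProp
  ¬¬-stableProp A =
    (¬ ¬ A) , (λ p q → funext λ k → contradiction k p) , negated-stable

  -- ι x is y ↦ ¬ ¬ (x ≡ y), read as an element of Ω¬¬.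
  ι : {X : Set} → X → ∇₀ X
  ι {X} x = ξ , (λ k → k (x , to x (λ k → k refl))) ,
            λ y z p q k → from y p λ x≡y → from z q λ x≡z → k (subst (_≡ z) x≡y x≡z)
    where
    ξ : X → Ω¬¬
    ξ y = code (¬¬-stableProp (x ≡ y))

    from : ∀ y → Holds (ξ y) → ¬ ¬ (x ≡ y)
    from y = subst id (Holds-code (¬¬-stableProp (x ≡ y)))

    to : ∀ y → ¬ ¬ (x ≡ y) → Holds (ξ y)
    to y = subst id (sym (Holds-code (¬¬-stableProp (x ≡ y))))

  Surjective : {X Y : Set} → (X → Y) → Set
  Surjective {X} {Y} f = (ν : Y) → ∥ Σ X (λ μ → f μ ≡ ν) ∥

  Oracle : Set → Set → Set
  Oracle A B = A → ∇₀ B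

  ○[_] : {A B : Set} → Oracle A B → HigherModality
  ○[ χ ] = Nullification λ a → χ a ↓

  _≤ᴹ_ : HigherModality → HigherModality → Set₁
  M ≤ᴹ N = (X : Set) → IsConnected M X → IsConnected N X

  _≤ᵀ_ : {A B A′ B′ : Set} → Oracle A B → Oracle A′ B′ → Set₁
  χ ≤ᵀ χ′ = ○[ χ ] ≤ᴹ ○[ χ′ ]

  _≡ᵀ_ : {A B A′ B′ : Set} → Oracle A B → Oracle A′ B′ → Set₁
  χ ≡ᵀ χ′ = ○[ χ ] ≡ ○[ χ′ ]

  -- Maps ℕ → ∇₀ ℕ correspond uniquely to maps ∇₀ ℕ → ∇₀ ℕ.
  oracle : (∇₀ ℕ → ∇₀ ℕ) → Oracle ℕ ℕ
  oracle g = g ∘ ι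

  IsSuc : ∇₀ ℕ → ∇₀ ℕ → Set
  IsSuc μ ν = (m : ℕ) → μ ↓= m → ν ↓= suc m

  MarkovInduction : Set₁
  MarkovInduction = (P : ∇₀ ℕ → Set) →
                    ((ν : ∇₀ ℕ) → ((μ : ∇₀ ℕ) → IsSuc μ ν → P μ) → P ν) →
                    (ν : ∇₀ ℕ) → P ν

{-# OPTIONS --without-K #-}

-- Let s ν be the least n with f (ι n) ≡ ν.  Such an n exists up to ¬¬, because
-- f is surjective and elements of ∇₀ ℕ are ¬¬-numerals, so s is a section.
-- To compute s (ι n) relative to f, ask the oracle for f (ι 0), f (ι 1), …
-- until the answer is n.  Markov induction on the distance s (ι n) − m that is
-- still to be searched shows that this terminates.
-- For a bijection the section is the inverse, so f⁻¹ and f reduce to each other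
-- and their modalities have the same modal types.  A higher modality is
-- determined by its modal types: the reflections agree by univalence, and the
-- remaining structure is a proposition.
module Submission where

open import Defs
open import Axiom.Extensionality.Propositional using (Extensionality)
open import Axiom.UniquenessOfIdentityProofs using (module Constant⇒UIP)
open import Data.Nat using (ℕ; zero; suc; _+_; _<_; _≟_)
open import Data.Nat.Induction using (<-rec)
open import Data.Nat.Properties using (+-identityʳ; +-suc; m<m+n; <-cmp; 0<1+n; suc-injective)
open import Data.Product using (Σ; _×_; _,_; proj₁; proj₂)
open import Function.Base using (id; const; _∘_)
open import Function.Bundles using (_⇔_; mk⇔; mk↔ₛ′; Equivalence)
open import Function.Properties.Inverse.HalfAdjointEquivalence using (↔⇒≃; module _≃_)
open import Level using (0ℓ; _⊔_)
open import Relation.Binary.Definitions using (tri<; tri≈; tri>)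
open import Relation.Binary.PropositionalEquality
  using (_≡_; refl; sym; trans; cong; cong-app; subst; trans-reflʳ)
open import Relation.Nullary using (yes; no)
open import Relation.Nullary.Irrelevant using (Irrelevant)
open import Relation.Nullary.Negation using (¬_; Stable; contradiction; ¬¬-map)

infix 4 _∼_

_∼_ : ∀ {a b} {A : Set a} {B : A → Set b} (g h : (x : A) → B x) → Set (a ⊔ b)
g ∼ h = ∀ x → g x ≡ h x

-- Equivalences and propositions

-- The inverse is first made half adjoint. Its triangle identity turns the path in the centre of the
-- fiber over `f x` into `cong f` of a path to `x`, which can be slid back to `refl`.
qinv⇒IsEquiv : ∀ {a b} {X : Set a} {Y : Set b} {f : X → Y} (g : Y → X) →
               (∀ x → g (f x) ≡ x) → (∀ y → f (g y) ≡ y) → IsEquiv f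
qinv⇒IsEquiv {X = X} {f = f} g gf fg y =
  (g y , right-inverse-of y) , λ { (x , refl) → contract x }
  where
  open _≃_ (↔⇒≃ (mk↔ₛ′ f g fg gf)) using (left-inverse-of; right-inverse-of; left-right)

  slide : ∀ {x x′} (p : x′ ≡ x) → (x′ , cong f p) ≡ (x , refl {x = f x})
  slide refl = refl

  contract : ∀ x → (g (f x) , right-inverse-of (f x)) ≡ (x , refl)
  contract x = trans (cong (g (f x) ,_) (sym (left-right x))) (slide (left-inverse-of x))

module _ {a b} {X : Set a} {Y : Set b} {f : X → Y} (e : IsEquiv f) where

  inv : Y → X
  inv y = proj₁ (proj₁ (e y))

  inv-right : ∀ y → f (inv y) ≡ y
  inv-right y = proj₂ (proj₁ (e y))

  inv-left : ∀ x → inv (f x) ≡ x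
  inv-left x = cong proj₁ (proj₂ (e (f x)) (x , refl))

  equiv-injective : ∀ {x x′} → f x ≡ f x′ → x ≡ x′
  equiv-injective {x} {x′} p = trans (sym (inv-left x)) (trans (cong inv p) (inv-left x′))

irrelevant⇒UIP : ∀ {a} {A : Set a} → Irrelevant A → {x y : A} → Irrelevant (x ≡ y)
irrelevant⇒UIP irr = Constant⇒UIP.≡-irrelevant (λ {x} {y} _ → irr x y) (λ _ _ → refl)

≡⇒≃-pointed : {X C D : Set} {c : X → C} {d : X → D} (p : C ≡ D) →
              Extensionality 0ℓ 0ℓ →
              proj₁ (≡⇒≃ C D p) ∘ c ∼ d → (C , c) ≡ (D , d)
≡⇒≃-pointed {C = C} refl ext h = cong (C ,_) (ext h)

-- Higher modalities

module Modality (M : HigherModality) where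
  open HigherModality M public using (○; η; ind; ind-η; ≡-modal)

  module _ {X : Set} {Y : ○ X → Set} (g h : (z : ○ X) → ○ (Y z))
           (p : ∀ x → g (η X x) ≡ h (η X x)) where

    -- Identity types of modal types are modal by `≡-modal`, so an equation between dependent maps
    -- may be proved by `ind`, on units only.
    ○-agree : g ∼ h
    ○-agree z = inv (≡-modal (Y z) (g z) (h z))
                    (ind X (λ z → g z ≡ h z) (λ x → η _ (p x)) z)

    ○-agree-η : ∀ x → ○-agree (η X x) ≡ p x
    ○-agree-η x = trans (cong (inv (≡-modal _ _ _)) (ind-η X _ _ x))
                        (inv-left (≡-modal _ _ _) (p x))

  ○-modal : ∀ X → IsModal M (○ X)
  ○-modal X = qinv⇒IsEquiv r (ind-η (○ X) _ id)
                (○-agree (η (○ X) ∘ r) id λ z → cong (η (○ X)) (ind-η (○ X) _ id z))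
    where
    r : ○ (○ X) → ○ X
    r = ind (○ X) (λ _ → X) id

  module _ {X Y : Set} (mY : IsModal M Y) (g : X → Y) where

    ○-rec : ○ X → Y
    ○-rec z = inv mY (ind X (λ _ → Y) (η Y ∘ g) z)

    ○-rec-η : ○-rec ∘ η X ∼ g
    ○-rec-η x = trans (cong (inv mY) (ind-η X _ _ x)) (inv-left mY (g x))

  ○-rec-const : ∀ {X Y} (mY : IsModal M Y) (y : Y) (z : ○ X) → ○-rec {X} mY (const y) z ≡ y
  ○-rec-const {X} {Y} mY y z =
    trans (cong (inv mY) (○-agree (ind X (λ _ → Y) (λ _ → η Y y)) (const (η Y y)) (ind-η X _ _) z))
          (inv-left mY y)

  η-constant⇒connected : ∀ {X} (c : ○ X) → (∀ x → c ≡ η X x) → IsConnected M X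
  η-constant⇒connected c p = c , ○-agree (const c) id p

  -- For a fixed `x`, the identity and the constant map at `η X x` agree on units, hence also at
  -- `c`.
  irrelevant⇒connected : ∀ {X} → Irrelevant X → ○ X → IsConnected M X
  irrelevant⇒connected {X} irr c = η-constant⇒connected c λ x →
    ○-agree id (const (η X x)) (λ x′ → cong (η X) (irr x′ x)) c

  -- The inverse of `const` extends `g` over `○ (B a)` and evaluates at the centre. Every unit
  -- equals the centre, so this value is `g b` for each `b`.
  connected⇒null : Extensionality 0ℓ 0ℓ →
                   {A : Set} {B : A → Set} → (∀ a → IsConnected M (B a)) →
                   ∀ {X} → IsModal M X → IsNull B X
  connected⇒null ext {B = B} conn {X} mX a =
    qinv⇒IsEquiv (λ g → ○-rec mX g c) (λ x → ○-rec-const mX x c) λ g → ext λ b →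
      trans (cong (○-rec mX g) (c≡ (η (B a) b))) (○-rec-η mX g b)
    where
    c  = proj₁ (conn a)
    c≡ = proj₂ (conn a)

module _ (H : HoTT) where
  open Theory H
  open Modality using (○-rec; ○-rec-η; ○-agree; ○-agree-η; ○-modal; η-constant⇒connected;
                       irrelevant⇒connected; connected⇒null)

  IsContr-irrelevant : ∀ {a} {A : Set a} → Irrelevant (IsContr A)
  IsContr-irrelevant {A = A} (x , p) (y , q) = go (p y) q
    where
    irr : Irrelevant A
    irr u v = trans (sym (p u)) (p v)

    go : ∀ {y} → x ≡ y → (q : ∀ z → y ≡ z) → (x , p) ≡ (y , q)
    go refl q = cong (x ,_) (funext λ z → irrelevant⇒UIP irr (p z) (q z))

  IsEquiv-irrelevant : ∀ {a b} {X : Set a} {Y : Set b} {f : X → Y} → Irrelevant (IsEquiv f)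
  IsEquiv-irrelevant e e′ = funext λ y → IsContr-irrelevant (e y) (e′ y)

  -- funext is not assumed to invert cong-app; induction on homotopies holds
  -- nevertheless, since a pair (h , K) is a section of a family of singletons.
  ∼-induction : ∀ {a b p} {A : Set a} {B : A → Set b} {g : ∀ x → B x}
                (P : (h : ∀ x → B x) → g ∼ h → Set p) →
                P g (λ _ → refl) → ∀ h (K : g ∼ h) → P h K
  ∼-induction {A = A} {B} {g} P base h K =
    subst (λ k → P (proj₁ ∘ k) (proj₂ ∘ k)) (funext λ x → contract (K x)) base
    where
    contract : ∀ {x} {v : B x} (p : g x ≡ v) → (g x , refl) ≡ (v , p)
    contract refl = refl

  -- Modalities are determined by their modal types

  -- A modality is split into carriers with units and two properties over them, so that a path
  -- between the first components can be eliminated before the properties are compared.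
  Reflection : Set₁
  Reflection = (X : Set) → Σ Set λ C → X → C

  Induction : Reflection → Set₁
  Induction F = (X : Set) (Y : proj₁ (F X) → Set) →
                (f : (x : X) → proj₁ (F (Y (proj₂ (F X) x)))) →
                Σ ((z : proj₁ (F X)) → proj₁ (F (Y z))) λ g → ∀ x → g (proj₂ (F X) x) ≡ f x

  ≡-Modal : Reflection → Set₁
  ≡-Modal F = (X : Set) (x y : proj₁ (F X)) → IsEquiv (proj₂ (F (x ≡ y)))

  modality : (F : Reflection) → Induction F → ≡-Modal F → HigherModality
  modality F I E = record
    { ○       = λ X → proj₁ (F X)
    ; η       = λ X → proj₂ (F X)
    ; ind     = λ X Y f → proj₁ (I X Y f)
    ; ind-η   = λ X Y f → proj₂ (I X Y f)
    ; ≡-modal = E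
    }

  module _ (M : HigherModality) where
    open HigherModality M using (○; η; ind; ind-η; ≡-modal)

    reflection : Reflection
    reflection X = ○ X , η X

    induction : Induction reflection
    induction X Y f = ind X Y f , ind-η X Y f

    -- Two extensions agree by `○-agree`. Contracting this homotopy to `refl` turns its computation
    -- rule `○-agree-η` into the coherence that identifies `G` with `K`.
    extension-irrelevant : (X : Set) (Y : ○ X → Set) (f : (x : X) → ○ (Y (η X x))) →
                           Irrelevant (Σ ((z : ○ X) → ○ (Y z)) λ g → g ∘ η X ∼ f)
    extension-irrelevant X Y f (g , G) (h , K) =
      ∼-induction
        (λ h p → (K : h ∘ η X ∼ f) → (∀ x → p (η X x) ≡ trans (G x) (sym (K x))) → (g , G) ≡ (h , K))
        (λ K coh → cong (g ,_) (funext λ x → cancel (G x) (K x) (coh x)))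
        h (○-agree M g h (λ x → trans (G x) (sym (K x)))) K (○-agree-η M g h _)
      where
      cancel : ∀ {A : Set} {u v : A} (p q : u ≡ v) → refl ≡ trans p (sym q) → p ≡ q
      cancel p refl coh = sym (trans coh (trans-reflʳ p))

    induction-irrelevant : Irrelevant (Induction reflection)
    induction-irrelevant I J =
      funext λ X → funext λ Y → funext λ f → extension-irrelevant X Y f (I X Y f) (J X Y f)

    ≡-Modal-irrelevant : Irrelevant (≡-Modal reflection)
    ≡-Modal-irrelevant E E′ =
      funext λ X → funext λ x → funext λ y → IsEquiv-irrelevant (E X x y) (E′ X x y)

  reflection-injective : ∀ {M N} → reflection M ≡ reflection N → M ≡ N
  reflection-injective {M} {N} p = go p (induction N) (HigherModality.≡-modal N)
    where
    go : ∀ {F} → reflection M ≡ F → (I : Induction F) (E : ≡-Modal F) → M ≡ modality F I E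
    -- By record eta, `M` is `modality` applied to its own components; these are replaced one at a
    -- time.
    go refl I E =
      trans (cong (λ J → modality (reflection M) J (HigherModality.≡-modal M))
                  (induction-irrelevant M (induction M) I))
            (cong (modality (reflection M) I)
                  (≡-Modal-irrelevant M (HigherModality.≡-modal M) E))

  module _ {M N : HigherModality} (M⇒N : ∀ X → IsModal M X → IsModal N X)
           (N⇒M : ∀ X → IsModal N X → IsModal M X) where
    private
      module M = Modality M
      module N = Modality N

    -- Each unit extends along the other, and both composites fix units, hence are identities. The
    -- path from univalence respects the units because `φ` does.
    modal-≡ : M ≡ N
    modal-≡ = reflection-injective (funext λ X →
      let φ  = M.○-rec (N⇒M _ (N.○-modal X)) (N.η X)
          φη = M.○-rec-η (N⇒M _ (N.○-modal X)) (N.η X)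
          ψ  = N.○-rec (M⇒N _ (M.○-modal X)) (M.η X)
          ψη = N.○-rec-η (M⇒N _ (M.○-modal X)) (M.η X)
          φ≃ : IsEquiv φ
          φ≃ = qinv⇒IsEquiv ψ
                 (M.○-agree (ψ ∘ φ) id λ x → trans (cong ψ (φη x)) (ψη x))
                 (N.○-agree (φ ∘ ψ) id λ x → trans (cong φ (ψη x)) (φη x))
          u  = univalence (M.○ X) (N.○ X)
      in ≡⇒≃-pointed (inv u (φ , φ≃)) funext λ x →
           trans (cong (λ e → proj₁ e (M.η X x)) (inv-right u (φ , φ≃))) (φη x))

  -- Reducibility of oracles

  -- The modal type `○ (χ a ↓)` is null at `χ a ↓`, so the unit is a constant map, and its value is
  -- the centre.
  ↓-connected : {A B : Set} (χ : Oracle A B) (a : A) → IsConnected ○[ χ ] (χ a ↓)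
  ↓-connected χ a = η-constant⇒connected ○[ χ ] (inv e (η _)) (cong-app (inv-right e (η _)))
    where
    open Modality ○[ χ ] using (η)
    e = Equivalence.to (modal⇔null _ _) (○-modal ○[ χ ] (χ a ↓)) a

  module _ {A B A′ B′ : Set} (χ : Oracle A B) (χ′ : Oracle A′ B′) where

    ↓-connected⇒modal : (∀ a → IsConnected ○[ χ′ ] (χ a ↓)) →
                        ∀ X → IsModal ○[ χ′ ] X → IsModal ○[ χ ] X
    ↓-connected⇒modal conn X mX =
      Equivalence.from (modal⇔null _ X) (connected⇒null ○[ χ′ ] funext conn mX)

    -- The unit of `X` for `χ′` lands in a type modal for `χ`, so it factors through the
    -- contractible reflection of `X` for `χ` and is constant.
    ↓-connected⇒≤ᵀ : (∀ a → IsConnected ○[ χ′ ] (χ a ↓)) → χ ≤ᵀ χ′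
    ↓-connected⇒≤ᵀ conn X (c , c≡) = η-constant⇒connected ○[ χ′ ] (g c) λ x →
      trans (cong g (c≡ _)) (○-rec-η ○[ χ ] modal (HigherModality.η ○[ χ′ ] X) x)
      where
      modal = ↓-connected⇒modal conn _ (○-modal ○[ χ′ ] X)
      g     = ○-rec ○[ χ ] modal (HigherModality.η ○[ χ′ ] X)

    ≤ᵀ⇒modal : χ ≤ᵀ χ′ → ∀ X → IsModal ○[ χ′ ] X → IsModal ○[ χ ] X
    ≤ᵀ⇒modal χ≤χ′ = ↓-connected⇒modal λ a → χ≤χ′ (χ a ↓) (↓-connected χ a)

  ≤ᵀ-antisym : {A B A′ B′ : Set} (χ : Oracle A B) (χ′ : Oracle A′ B′) →
               χ ≤ᵀ χ′ → χ′ ≤ᵀ χ → χ ≡ᵀ χ′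
  ≤ᵀ-antisym χ χ′ χ≤χ′ χ′≤χ =
    modal-≡ (≤ᵀ⇒modal χ′ χ χ′≤χ) (≤ᵀ⇒modal χ χ′ χ≤χ′)

  -- The type ∇₀ X

  ¬¬StableProp-≡ : {P Q : ¬¬StableProp} → (proj₁ P → proj₁ Q) → (proj₁ Q → proj₁ P) → P ≡ Q
  ¬¬StableProp-≡ {P , iP , sP} {Q , iQ , sQ} f g =
    go (inv (univalence P Q) (f , qinv⇒IsEquiv g (λ p → iP _ p) (λ q → iQ _ q))) iQ sQ
    where
    go : ∀ {Q} → P ≡ Q → (iQ : Irrelevant Q) (sQ : Stable Q) → (P , iP , sP) ≡ (Q , iQ , sQ)
    go refl iQ sQ = trans
      (cong (λ i → P , i , sP) (funext λ p → funext λ q → irrelevant⇒UIP iP (iP p q) (iQ p q)))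
      (cong (λ s → P , iQ , s) (funext λ k → iP (sP k) (sQ k)))

  Holds-irrelevant : ∀ p → Irrelevant (Holds p)
  Holds-irrelevant p = proj₁ (proj₂ (proj₁ classify p))

  Holds-stable : ∀ p → Stable (Holds p)
  Holds-stable p = proj₂ (proj₂ (proj₁ classify p))

  Holds-ext : ∀ {p q} → (Holds p → Holds q) → (Holds q → Holds p) → p ≡ q
  Holds-ext f g = equiv-injective (proj₂ classify) (¬¬StableProp-≡ f g)

  Holds-¬¬ : (A : Set) → Holds (code (¬¬-stableProp A)) ⇔ (¬ ¬ A)
  Holds-¬¬ A = mk⇔ (subst id (Holds-code (¬¬-stableProp A))) (subst id (sym (Holds-code (¬¬-stableProp A))))

  module _ {X : Set} where

    ↓=-stable : (ξ : ∇₀ X) {x : X} → Stable (ξ ↓= x)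
    ↓=-stable (ξ , _) {x} = Holds-stable (ξ x)

    -- The reverse inclusion follows: up to double negation `ξ` holds somewhere, `ζ` then holds
    -- there too, and `ζ` has at most one value.
    ∇₀-ext : {ξ ζ : ∇₀ X} → (∀ x → ξ ↓= x → ζ ↓= x) → ξ ≡ ζ
    ∇₀-ext {ξ , ne , un} {ζ , ne′ , un′} ξ⇒ζ =
      go (funext λ x → Holds-ext (ξ⇒ζ x) (ζ⇒ξ x)) ne′ un′
      where
      ζ⇒ξ : ∀ x → Holds (ζ x) → Holds (ξ x)
      ζ⇒ξ x q = Holds-stable (ξ x) λ k → ne λ { (y , p) →
        un′ y x (ξ⇒ζ y p) q λ { refl → k p } }

      go : ∀ {ζ} → ξ ≡ ζ → ∀ ne′ un′ → (ξ , ne , un) ≡ (ζ , ne′ , un′)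
      go refl ne′ un′ = trans
        (cong (λ n → ξ , n , un) (funext λ k → contradiction k ne))
        (cong (λ u → ξ , ne′ , u)
          (funext λ x → funext λ y → funext λ p → funext λ q → funext λ k → contradiction k (un x y p q)))

    ∇₀-≡-stable : {ξ ζ : ∇₀ X} → Stable (ξ ≡ ζ)
    ∇₀-≡-stable {ξ} {ζ} k = ∇₀-ext λ x p → ↓=-stable ζ (¬¬-map (λ e → subst (_↓= x) e p) k)

    module _ (Q : X → Set) (ne : ¬ ¬ Σ X Q) (un : ∀ {x y} → Q x → Q y → x ≡ y) where

      -- Definite description. The predicate is double negated because `Ω¬¬` classifies stable
      -- propositions only.
      the : ∇₀ X
      the = (λ x → code (¬¬-stableProp (Q x))) ,
            ¬¬-map (λ { (x , q) → x , Equivalence.from (Holds-¬¬ (Q x)) (λ k → k q) }) ne ,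
            λ x y p q k → Equivalence.to (Holds-¬¬ (Q x)) p λ p →
                          Equivalence.to (Holds-¬¬ (Q y)) q λ q → k (un p q)

      the-↓= : ∀ {x} → the ↓= x ⇔ (¬ ¬ Q x)
      the-↓= {x} = Holds-¬¬ (Q x)

    ι-↓= : ∀ x y → ι {X} x ↓= y ⇔ (¬ ¬ (x ≡ y))
    ι-↓= x y = Holds-¬¬ (x ≡ y)

    ↓=⇒≡ι : (ξ : ∇₀ X) {x : X} → ξ ↓= x → ξ ≡ ι x
    ↓=⇒≡ι (ξ , _ , un) {x} p = ∇₀-ext λ y q → Equivalence.from (ι-↓= x y) (un x y p q)

  -- Decidable equality on `ℕ` removes the double negation from uniqueness.
  ℕ-↓=-unique : (ξ : ∇₀ ℕ) {m n : ℕ} → ξ ↓= m → ξ ↓= n → m ≡ n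
  ℕ-↓=-unique (_ , _ , un) {m} {n} p q with m ≟ n
  ... | yes m≡n = m≡n
  ... | no  m≢n = contradiction m≢n (un m n p q)

  ℕ-↓-irrelevant : (ξ : ∇₀ ℕ) → Irrelevant (ξ ↓)
  ℕ-↓-irrelevant ξ (m , p) (n , q) = go (ℕ-↓=-unique ξ p q) q
    where
    go : ∀ {n} → m ≡ n → (q : ξ ↓= n) → (m , p) ≡ (n , q)
    go refl q = cong (m ,_) (Holds-irrelevant (proj₁ ξ m) p q)

  nonzero⇒predecessor : (ν : ∇₀ ℕ) → ¬ ν ↓= 0 → Σ (∇₀ ℕ) λ μ → ∀ m → μ ↓= m ⇔ ν ↓= suc m
  nonzero⇒predecessor ν ν≢0 = the Q ne un , λ m →
    mk⇔ (λ p → ↓=-stable ν (Equivalence.to (the-↓= Q ne un) p))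
        (λ q → Equivalence.from (the-↓= Q ne un) (λ k → k q))
    where
    Q : ℕ → Set
    Q m = ν ↓= suc m

    ne : ¬ ¬ Σ ℕ Q
    ne = ¬¬-map (λ { (zero , p) → contradiction p ν≢0 ; (suc m , p) → m , p }) (proj₁ (proj₂ ν))

    un : ∀ {m n} → Q m → Q n → m ≡ n
    un p q = suc-injective (ℕ-↓=-unique ν p q)

  -- The least section

  Least : (ℕ → Set) → ℕ → Set
  Least Q n = Q n × (∀ {m} → m < n → ¬ Q m)

  -- Under the refutation `k`, any smaller witness would recursively give a contradiction, so `n`
  -- itself is least.
  Least-exists : {Q : ℕ → Set} → ∀ n → Q n → ¬ ¬ Σ ℕ (Least Q)
  Least-exists {Q} = <-rec (λ n → Q n → ¬ ¬ Σ ℕ (Least Q)) λ n rec q k →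
    k (n , q , λ m<n q′ → rec m<n q′ k)

  Least-unique : {Q : ℕ → Set} → ∀ {m n} → Least Q m → Least Q n → m ≡ n
  Least-unique {m = m} {n} (p , p-least) (q , q-least) with <-cmp m n
  ... | tri< m<n _ _ = contradiction p (q-least m<n)
  ... | tri≈ _ m≡n _ = m≡n
  ... | tri> _ _ n<m = contradiction q (p-least n<m)

  module LeastSection (f : ∇₀ ℕ → ∇₀ ℕ) (surj : Surjective f) where

    Preimage : ∇₀ ℕ → ℕ → Set
    Preimage ν n = f (ι n) ≡ ν

    preimage : ∀ ν → ¬ ¬ Σ ℕ (Preimage ν)
    preimage ν = ∥∥-elim {P = λ _ → ¬ ¬ Σ ℕ (Preimage ν)} (λ _ p q → funext λ k → contradiction k p)
      (λ { (μ , fμ≡ν) → ¬¬-map (λ { (n , p) → n , trans (cong f (sym (↓=⇒≡ι μ p))) fμ≡ν })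
                               (proj₁ (proj₂ μ)) })
      (surj ν)

    least-preimage : ∀ ν → ¬ ¬ Σ ℕ (Least (Preimage ν))
    least-preimage ν k = preimage ν λ { (n , p) → Least-exists n p k }

    section : ∇₀ ℕ → ∇₀ ℕ
    section ν = the (Least (Preimage ν)) (least-preimage ν) Least-unique

    section-↓= : ∀ {ν n} → section ν ↓= n ⇔ (¬ ¬ Least (Preimage ν) n)
    section-↓= {ν} = the-↓= (Least (Preimage ν)) (least-preimage ν) Least-unique

    f∘section : f ∘ section ≡ id
    f∘section = funext λ ν → ∇₀-≡-stable λ k → least-preimage ν λ { (n , l) →
      k (trans (cong f (↓=⇒≡ι (section ν) (Equivalence.from section-↓= (λ k → k l)))) (proj₁ l)) }

    module _ (MI : MarkovInduction) (n : ℕ) where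

      Answer : Set
      Answer = HigherModality.○ ○[ oracle f ] (section (ι n) ↓)

      -- One oracle call: `Answer` is null at `f (ι m) ↓`, so an answer may be built as if the value
      -- of `f (ι m)` were known.
      query : ∀ m → (f (ι m) ↓ → Answer) → Answer
      query m = inv (Equivalence.to (modal⇔null _ _) (○-modal ○[ oracle f ] _) m)

      -- The search invariant: `ν` is the distance from `m` to the least preimage, which has not
      -- been passed.
      RemainingFrom : ℕ → ∇₀ ℕ → Set
      RemainingFrom m ν = ∀ k → ν ↓= k → section (ι n) ↓= (m + k)

      -- A positive distance would make `m` a preimage below the least one.
      found : ∀ {m ν} → RemainingFrom m ν → f (ι m) ≡ ι n → section (ι n) ↓= m
      found {m} {ν} rem fm≡n = ↓=-stable (section (ι n)) λ k → proj₁ (proj₂ ν) λ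
        { (zero  , p) → k (subst (section (ι n) ↓=_) (+-identityʳ m) (rem 0 p))
        ; (suc j , p) → Equivalence.to section-↓= (rem (suc j) p) λ l →
                          proj₂ l (m<m+n m 0<1+n) fm≡n }

      -- At distance zero `m` is the least preimage, so the oracle would have answered `n`. The
      -- distance therefore has a predecessor, on which Markov induction can recurse.
      not-found : ∀ {m ν j} → RemainingFrom m ν → f (ι m) ↓= j → ¬ j ≡ n → ¬ ν ↓= 0
      not-found {m} {j = j} rem p j≢n z =
        Equivalence.to section-↓= (subst (section (ι n) ↓=_) (+-identityʳ m) (rem 0 z)) λ l →
          Equivalence.to (ι-↓= n j) (subst (_↓= j) (proj₁ l) p) λ n≡j → j≢n (sym n≡j)

      search : ∀ ν m → RemainingFrom m ν → Answer
      -- The motive quantifies over `m`, since `m` grows as `ν` shrinks.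
      search = MI (λ ν → ∀ m → RemainingFrom m ν → Answer) λ ν rec m rem →
        query m λ { (j , p) → step ν rec m rem j p }
        where
        step : ∀ ν → (∀ μ → IsSuc μ ν → ∀ m → RemainingFrom m μ → Answer) →
               ∀ m → RemainingFrom m ν → ∀ j → f (ι m) ↓= j → Answer
        step ν rec m rem j p with j ≟ n
        ... | yes refl = HigherModality.η ○[ oracle f ] _ (m , found {ν = ν} rem (↓=⇒≡ι (f (ι m)) p))
        ... | no j≢n with nonzero⇒predecessor ν (not-found {ν = ν} rem p j≢n)
        ...   | μ , μ-pred = rec μ (λ k → Equivalence.to (μ-pred k)) (suc m) λ k q →
                subst (section (ι n) ↓=_) (+-suc m k) (rem (suc k) (Equivalence.to (μ-pred k) q))

      section-connected : IsConnected ○[ oracle f ] (section (ι n) ↓)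
      section-connected = irrelevant⇒connected ○[ oracle f ] (ℕ-↓-irrelevant (section (ι n)))
                            -- Starting at zero, the distance is the sought value itself.
                            (search (section (ι n)) 0 λ k p → p)

    section≤ᵀ : MarkovInduction → oracle section ≤ᵀ oracle f
    section≤ᵀ MI = ↓-connected⇒≤ᵀ (oracle section) (oracle f) (section-connected MI)

  -- A bijection has only one section, so the least section of `f` is `g`.
  inverse≤ᵀ : MarkovInduction → (f g : ∇₀ ℕ → ∇₀ ℕ) → f ∘ g ≡ id → g ∘ f ≡ id →
              oracle g ≤ᵀ oracle f
  inverse≤ᵀ MI f g fg gf = subst (λ h → oracle h ≤ᵀ oracle f) section≡g (section≤ᵀ MI)
    where
    open LeastSection f (λ ν → ∣ g ν , cong-app fg ν ∣)

    section≡g : section ≡ g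
    section≡g = trans (cong (_∘ section) (sym gf)) (cong (g ∘_) f∘section)

mainTheorem13 : (H : HoTT) → let open Theory H in
    MarkovInduction →
    (f : ∇₀ ℕ → ∇₀ ℕ) →
    (Surjective f → Σ (∇₀ ℕ → ∇₀ ℕ) λ s → (f ∘ s ≡ id) × (oracle s ≤ᵀ oracle f)) ×
    ((f⁻¹ : ∇₀ ℕ → ∇₀ ℕ) → f ∘ f⁻¹ ≡ id → f⁻¹ ∘ f ≡ id → oracle f⁻¹ ≡ᵀ oracle f)
mainTheorem13 H MI f =
  let open Theory H using (oracle) in
  (λ surj → let open LeastSection H f surj in section , f∘section , section≤ᵀ MI) ,
  λ f⁻¹ ff⁻¹ f⁻¹f → ≤ᵀ-antisym H (oracle f⁻¹) (oracle f)
    (inverse≤ᵀ H MI f f⁻¹ ff⁻¹ f⁻¹f)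
    (inverse≤ᵀ H MI f⁻¹ f f⁻¹f ff⁻¹)
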